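{- Let $C,D$ be posets and let $s\dashv t:D\to C$ be a Galois connection between them. A poset $X$ is isomorphic to $\mathrm{Fix}(ts)$ if, and only if, there exist surjective maps $l:C\to X$ and $r:D\to X$ such that for all $c\in C$ and all $d\in D$: $s(c)\leq d$ in $D$ $\iff$ $l(c)\leq r(d)$ in $X$.
   Context: A Galois connection $s\dashv t:D\to C$ between posets $C,D$ consists of monotone maps $s:C\to D$, $t:D\to C$ such that $s(x)\leq y\iff x\leq t(y)$ for all $x\in C$, $y\in D$. $\mathrm{Fix}(ts)=\{x\in C\mid x=ts(x)\}$, with the order inherited from $C$. The maps $l,r$ are maps of underlying sets (not assumed monotone). -}

module Defs where

open import Data.Product using (Σ-syntax; proj₁)
open import Level using (Level; _⊔_)
open import Relation.Binary.Bundles using (Poset)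
open import Relation.Binary.Construct.On as On using ()
open import Relation.Binary.Definitions using (Adjoint)
open import Relation.Binary.Morphism.Bundles using (PosetHomomorphism)
open import Relation.Binary.Morphism.Structures using (IsOrderIsomorphism)

private
  variable
    a₁ a₂ a₃ b₁ b₂ b₃ : Level

-- Equality in a poset is its setoid equality _≈_.  A map of underlying sets is
-- accordingly a function respecting _≈_ (e.g. `Function.Bundles.Surjection`
-- when surjective), with no monotonicity required.

-- The left adjoint s goes from C to D.
record GaloisConnection (C : Poset a₁ a₂ a₃) (D : Poset b₁ b₂ b₃)
                        : Set (a₁ ⊔ a₂ ⊔ a₃ ⊔ b₁ ⊔ b₂ ⊔ b₃) where
  private
    module C = Poset C
    module D = Poset D
  field
    left  : PosetHomomorphism C D
    right : PosetHomomorphism D C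

  open PosetHomomorphism left  public using () renaming (⟦_⟧ to s)
  open PosetHomomorphism right public using () renaming (⟦_⟧ to t)

  field
    adjoint : Adjoint C._≤_ D._≤_ s t

-- An element of Fix is an x together with a proof of x ≈ t (s x); pulling back
-- along proj₁ makes both equality and order ignore that proof.
Fix : {C : Poset a₁ a₂ a₃} {D : Poset b₁ b₂ b₃} →
      GaloisConnection C D → Poset (a₁ ⊔ a₂) a₂ a₃
Fix {C = C} G = On.poset C (proj₁ {B = λ x → x ≈ t (s x)})
  where
  open Poset C using (_≈_)
  open GaloisConnection G using (s; t)

infix 4 _≅_

_≅_ : Poset a₁ a₂ a₃ → Poset b₁ b₂ b₃ → Set (a₁ ⊔ a₂ ⊔ a₃ ⊔ b₁ ⊔ b₂ ⊔ b₃)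
P ≅ Q = Σ[ f ∈ (P.Carrier → Q.Carrier) ]
          IsOrderIsomorphism P._≈_ Q._≈_ P._≤_ Q._≤_ f
  where
  module P = Poset P
  module Q = Poset Q

{-# OPTIONS --safe #-}
module Submission where

-- Write S for the relation s c ≤ d between c ∈ C and d ∈ D; by adjointness it
-- says c ≤ t d, equivalently t s c ≤ t d.
--
-- Fix(ts) itself carries a pair of surjections representing S, namely
-- c ↦ t s c and d ↦ t d (`fix-represents`): a fixed point x is the image of x
-- under the first and of s x under the second.  An isomorphism X ≅ Fix(ts)
-- transports this pair to X.
--
-- Conversely, let l : C → X and r : D → X represent S with l surjective.  Then
-- l c ≤ r d iff c ≤ t d.  Every element of X is some l c, so r d ≤ r d′ holds
-- iff every c below t d is below t d′, that is, iff t d ≤ t d′ (`r-mono`,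
-- `r-cancel`).  Since r is surjective as well, X is isomorphic to the image of
-- t, ordered as a subset of C, and that image is Fix(ts).

open import Data.Product using (Σ-syntax; _,_; proj₁; proj₂)
open import Function.Base using (_∘_)
open import Function.Bundles using (_⇔_; Surjection; Equivalence; mk⇔)
import Function.Construct.Composition as Compose
open import Function.Consequences.Setoid using (strictlySurjective⇒surjective)
open import Level using (Level)
open import Relation.Binary.Bundles using (Poset)
open import Relation.Binary.Consequences using (mono⇒cong)
open import Relation.Binary.Morphism.Bundles using (PosetHomomorphism)
open import Relation.Binary.Morphism.Structures using (IsOrderIsomorphism)
import Relation.Binary.Reasoning.PartialOrder as PosetReasoning
open import Defs

private
  variable
    a₁ a₂ a₃ b₁ b₂ b₃ x₁ x₂ x₃ : Level

module _ {P : Poset a₁ a₂ a₃} {Q : Poset b₁ b₂ b₃} where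
  private
    module P = Poset P
    module Q = Poset Q

  surjectiveEmbedding⇒≅ :
    (f : P.Carrier → Q.Carrier) →
    (∀ {x y} → x P.≤ y → f x Q.≤ f y) →
    (∀ {x y} → f x Q.≤ f y → x P.≤ y) →
    (∀ y → Σ[ x ∈ P.Carrier ] f x Q.≈ y) →
    P ≅ Q
  surjectiveEmbedding⇒≅ f mono cancel onto = f , record
    { isOrderMonomorphism = record
      { isOrderHomomorphism = record { cong = cong ; mono = mono }
      ; injective = λ fx≈fy → P.antisym (cancel (Q.reflexive fx≈fy))
                                        (cancel (Q.reflexive (Q.Eq.sym fx≈fy)))
      ; cancel = cancel
      }
    ; surjective = strictlySurjective⇒surjective P.Eq.setoid Q.Eq.setoid cong onto
    }
    where
    cong : ∀ {x y} → x P.≈ y → f x Q.≈ f y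
    cong = mono⇒cong P._≈_ Q._≈_ P.Eq.sym P.reflexive Q.antisym mono

  ≅⇒surjection : P ≅ Q → Surjection P.Eq.setoid Q.Eq.setoid
  ≅⇒surjection (f , iso) = record { to = f ; cong = cong ; surjective = surjective }
    where open IsOrderIsomorphism iso

≅-sym : {P : Poset a₁ a₂ a₃} {Q : Poset b₁ b₂ b₃} → P ≅ Q → Q ≅ P
≅-sym {P = P} {Q = Q} φ@(f , iso) = surjectiveEmbedding⇒≅ {P = Q} {Q = P} to⁻
  (λ {x} {y} x≤y → cancel (begin
    f (to⁻ x)  ≈⟨ to∘to⁻ x ⟩
    x          ≤⟨ x≤y ⟩
    y          ≈⟨ to∘to⁻ y ⟨
    f (to⁻ y)  ∎))
  (λ {x} {y} x≤y → begin
    x          ≈⟨ to∘to⁻ x ⟨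
    f (to⁻ x)  ≤⟨ mono x≤y ⟩
    f (to⁻ y)  ≈⟨ to∘to⁻ y ⟩
    y          ∎)
  (λ x → f x , injective (to∘to⁻ (f x)))
  where
  open IsOrderIsomorphism iso using (mono; cancel; injective)
  open Surjection (≅⇒surjection {P = P} {Q = Q} φ) using (to⁻; to∘to⁻)
  open PosetReasoning Q

module _ {C : Poset a₁ a₂ a₃} {D : Poset b₁ b₂ b₃} (G : GaloisConnection C D) where
  private
    module C = Poset C
    module D = Poset D
    module F = Poset (Fix G)
  open GaloisConnection G
  open PosetHomomorphism left  using () renaming (mono to s-mono; cong to s-cong)
  open PosetHomomorphism right using () renaming (mono to t-mono; cong to t-cong)

  -- The maps l and r represent the relation s c ≤ d by the order of X.
  Represents : (X : Poset x₁ x₂ x₃) →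
               Surjection C.Eq.setoid (Poset.Eq.setoid X) →
               Surjection D.Eq.setoid (Poset.Eq.setoid X) → Set _
  Represents X l r =
    ∀ (c : C.Carrier) (d : D.Carrier) →
      (s c D.≤ d) ⇔ (Surjection.to l c X.≤ Surjection.to r d)
    where module X = Poset X

  unit : ∀ c → c C.≤ t (s c)
  unit c = proj₁ adjoint D.refl

  counit : ∀ d → s (t d) D.≤ d
  counit d = proj₂ adjoint C.refl

  t-fixed : ∀ d → t d C.≈ t (s (t d))
  t-fixed d = C.antisym (unit (t d)) (t-mono (counit d))

  t-surjection : Surjection D.Eq.setoid F.Eq.setoid
  t-surjection = record
    { to         = t′
    ; cong       = t-cong
    ; surjective = strictlySurjective⇒surjective D.Eq.setoid F.Eq.setoid {f = t′}
                     t-cong (λ (x , x≈tsx) → s x , C.Eq.sym x≈tsx)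
    }
    where
    t′ : D.Carrier → F.Carrier
    t′ d = t d , t-fixed d

  ts-surjection : Surjection C.Eq.setoid F.Eq.setoid
  ts-surjection = record
    { to         = ts′
    ; cong       = t-cong ∘ s-cong
    ; surjective = strictlySurjective⇒surjective C.Eq.setoid F.Eq.setoid {f = ts′}
                     (t-cong ∘ s-cong) (λ (x , x≈tsx) → x , C.Eq.sym x≈tsx)
    }
    where
    ts′ : C.Carrier → F.Carrier
    ts′ c = t (s c) , t-fixed (s c)

  fix-represents : Represents (Fix G) ts-surjection t-surjection
  fix-represents c d = mk⇔ t-mono (λ tsc≤td → proj₂ adjoint (C.trans (unit c) tsc≤td))

  module _ {X : Poset x₁ x₂ x₃} where
    private
      module X = Poset X

    ≅Fix⇒represented : X ≅ Fix G →
      Σ[ l ∈ Surjection C.Eq.setoid X.Eq.setoid ]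
      Σ[ r ∈ Surjection D.Eq.setoid X.Eq.setoid ] Represents X l r
    ≅Fix⇒represented φ =
      Compose.surjection ts-surjection ψ↠ ,
      Compose.surjection t-surjection ψ↠ ,
      λ c d → Compose.equivalence (fix-represents c d) (mk⇔ mono cancel)
      where
      ψ : Fix G ≅ X
      ψ = ≅-sym {P = X} {Q = Fix G} φ
      ψ↠ : Surjection F.Eq.setoid X.Eq.setoid
      ψ↠ = ≅⇒surjection {P = Fix G} {Q = X} ψ
      open IsOrderIsomorphism (proj₂ ψ) using (mono; cancel)

    module _ (l : Surjection C.Eq.setoid X.Eq.setoid)
             (r : Surjection D.Eq.setoid X.Eq.setoid)
             (rep : Represents X l r) where
      private
        module l = Surjection l
        module r = Surjection r

      l≤r⇒≤t : ∀ {c d} → l.to c X.≤ r.to d → c C.≤ t d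
      l≤r⇒≤t lc≤rd = proj₁ adjoint (Equivalence.from (rep _ _) lc≤rd)

      ≤t⇒l≤r : ∀ {c d} → c C.≤ t d → l.to c X.≤ r.to d
      ≤t⇒l≤r c≤td = Equivalence.to (rep _ _) (proj₂ adjoint c≤td)

      r-mono : ∀ {d d′} → t d C.≤ t d′ → r.to d X.≤ r.to d′
      r-mono {d} {d′} td≤td′ = begin
        r.to d   ≈⟨ l.to∘to⁻ (r.to d) ⟨
        l.to c   ≤⟨ ≤t⇒l≤r (C.trans c≤td td≤td′) ⟩
        r.to d′  ∎
        where
        open PosetReasoning X
        c : C.Carrier
        c = l.to⁻ (r.to d)
        c≤td : c C.≤ t d
        c≤td = l≤r⇒≤t (X.reflexive (l.to∘to⁻ (r.to d)))

      r-cancel : ∀ {d d′} → r.to d X.≤ r.to d′ → t d C.≤ t d′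
      r-cancel rd≤rd′ = l≤r⇒≤t (X.trans (≤t⇒l≤r C.refl) rd≤rd′)

      -- The isomorphism sends x to t d for a chosen d with r d ≈ x.
      represented⇒≅Fix : X ≅ Fix G
      represented⇒≅Fix = surjectiveEmbedding⇒≅ {P = X} {Q = Fix G}
        (λ x → t (r.to⁻ x) , t-fixed (r.to⁻ x))
        (λ {x} {y} x≤y → r-cancel (begin
          r.to (r.to⁻ x)  ≈⟨ r.to∘to⁻ x ⟩
          x               ≤⟨ x≤y ⟩
          y               ≈⟨ r.to∘to⁻ y ⟨
          r.to (r.to⁻ y)  ∎))
        (λ {x} {y} tx≤ty → begin
          x               ≈⟨ r.to∘to⁻ x ⟨
          r.to (r.to⁻ x)  ≤⟨ r-mono tx≤ty ⟩
          r.to (r.to⁻ y)  ≈⟨ r.to∘to⁻ y ⟩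
          y               ∎)
        -- A fixed point c ≈ t (s c) is hit by r (s c): the chosen preimage d of
        -- r (s c) may differ from s c, but t d ≈ t (s c).
        (λ (c , c≈tsc) →
          let rd≈rsc = r.to∘to⁻ (r.to (s c)) in
          r.to (s c) ,
          C.Eq.trans
            (C.antisym (r-cancel (X.reflexive rd≈rsc))
                       (r-cancel (X.reflexive (X.Eq.sym rd≈rsc))))
            (C.Eq.sym c≈tsc))
        where open PosetReasoning X

theorem1p1 :
    {c₁ c₂ c₃ d₁ d₂ d₃ x₁ x₂ x₃ : Level}
    (C : Poset c₁ c₂ c₃) (D : Poset d₁ d₂ d₃) (G : GaloisConnection C D)
    (X : Poset x₁ x₂ x₃) →
    let module C = Poset C
        module D = Poset D
        module X = Poset X
        open GaloisConnection G using (s)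
        open Surjection using (to)
    in
    (X ≅ Fix G) ⇔
    (Σ[ l ∈ Surjection C.Eq.setoid X.Eq.setoid ]
     Σ[ r ∈ Surjection D.Eq.setoid X.Eq.setoid ]
       (∀ (c : C.Carrier) (d : D.Carrier) → (s c D.≤ d) ⇔ (to l c X.≤ to r d)))
theorem1p1 C D G X = mk⇔
  (≅Fix⇒represented G {X = X})
  (λ (l , r , rep) → represented⇒≅Fix G {X = X} l r rep)
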